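{- Let $r_1,r_2,r_3,r_4,r_5\in\mathbb{Z}$. Then $$S(r_1,r_2,r_3;r_4,r_5)+\frac{r_5}{g_1}S(r_1',r_2',-r_3;r_5,g_1)=A,$$ where $$g_1=\Big\{\frac{r_4}{r_5}\Big\}r_5,\qquad r_1'=\Big[\frac{r_3+g_1r_1}{r_5}\Big]+2,\qquad r_2'=\Big[\frac{r_3+g_1r_2}{r_5}\Big]-1,$$ $$\begin{aligned}A={}&(r_2-r_1+1)r_3+\frac{g_1}{2}(r_2+r_1)(r_2-r_1+1)\\&-r_5\Bigg(-\Big[\frac{(r_1'-1)r_5-r_3}{g_1}\Big]+(r_1'-2)(-r_1+1)+q-\Big[\frac{(r_2'+1)r_5-r_3}{g_1}\Big]+(r_2'+1)r_2\\&\qquad+\frac{r_3}{g_1}(r_2'-r_1'+1)-\frac{r_5}{2g_1}(r_2'+r_1')(r_2'-r_1'+1)\Bigg),\end{aligned}$$ $$q=\begin{cases}0, & \gcd(r_5,g_1)\nmid r_3,\\[1mm] \Bigg[\dfrac{r_2'-r_1'+2-r}{\frac{g_1}{\gcd(r_5,g_1)}}\Bigg]+1, & \gcd(r_5,g_1)\mid r_3,\end{cases}$$ $$r=\left\{\frac{\Big(\frac{r_3}{\gcd(r_5,g_1)}-(r_1'-1)\frac{r_5}{\gcd(r_5,g_1)}\Big)\Big(\frac{r_5}{\gcd(r_5,g_1)}\Big)^{ -1}}{\frac{g_1}{\gcd(r_5,g_1)}}\right\}\frac{g_1}{\gcd(r_5,g_1)},$$ in which $\big(\frac{r_5}{\gcd(r_5,g_1)}\big)^{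 -1}\in\mathbb{Z}$ and $\big(\frac{r_5}{\gcd(r_5,g_1)}\big)^{ -1}\frac{r_5}{\gcd(r_5,g_1)}\equiv 1\pmod{\frac{g_1}{\gcd(r_5,g_1)}}$.
   Context: For a rational number $y$, $[y]$ is the floor (greatest integer $\le y$) and $\{y\}=y-[y]$ is the fractional part. For integers $s_1,s_2,s_3,s_4,s_5$, the fractional part sum $S$ is defined by $$S(s_1,s_2,s_3;s_4,s_5)=\sum_{x=s_1}^{s_2}\Big\{\frac{s_3+s_4x}{s_5}\Big\}s_5.$$
   Formalization: Assumes r₅, g₁ ≠ 0; a sum whose upper limit is below its lower limit is read as oriented (minus the sum over the gap), not as 0; in q and r the modulus g₁/gcd(r₅,g₁) is replaced by |g₁|/gcd(r₅,g₁), which matters only for r₅ < 0. As printed the identity fails in these cases. -}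

module Defs where

open import Data.Bool.Base using (if_then_else_)
open import Data.Integer.Base
  using (ℤ; +_; +[1+_]; -[1+_]; 0ℤ; 1ℤ; _+_; _-_; -_; _*_; ∣_∣; _/_; NonZero)
open import Data.Integer.Divisibility.Signed using (_∣_; _∣?_)
open import Data.Integer.GCD using (gcd)
import Data.Integer.Properties as ℤ
open import Data.Nat.Base as ℕ using (ℕ; zero; suc)
import Data.Nat.GCD as ℕ
open import Data.Rational.Base as ℚ using (ℚ; 0ℚ; floor)
import Data.Rational.Properties as ℚ
open import Data.Sum.Base using (inj₂)
open import Relation.Binary.PropositionalEquality.Core using (subst; sym)
open import Relation.Nullary.Decidable.Core using (does)

ι : ℤ → ℚ
ι i = i ℚ./ 1

ι-nonZero : ∀ i .{{_ : NonZero i}} → ℚ.NonZero (ι i)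
ι-nonZero +[1+ n ] = ℚ.pos⇒nonZero (ι +[1+ n ]) {{ℚ.normalize-pos (suc n) 1}}
ι-nonZero -[1+ n ] =
  ℚ.neg⇒nonZero (ι -[1+ n ])
    {{ℚ.neg-pos {ℚ.normalize (suc n) 1} (ℚ.normalize-pos (suc n) 1)}}

infixl 7 _÷ᶻ_

_÷ᶻ_ : (i j : ℤ) .{{_ : NonZero j}} → ℚ
i ÷ᶻ j = (ι i ℚ.÷ ι j) {{ι-nonZero j}}

-- Not the library's fracPart, which is ∣ y - truncate y ∣ and differs from
-- y - ⌊ y ⌋ on negative non-integers.
frac : ℚ → ℚ
frac y = y ℚ.- ι (floor y)

sumFrom : (ℤ → ℚ) → ℤ → ℕ → ℚ
sumFrom f a zero    = 0ℚ
sumFrom f a (suc n) = f a ℚ.+ sumFrom f (a + 1ℤ) n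

-- ∑ f a b is the sum of f x for a ≤ x ≤ b, extended to b < a by the usual
-- oriented convention ∑ f a b = - ∑ f (b + 1) (a - 1), under which
-- ∑ f a b + ∑ f (b + 1) c = ∑ f a c for all a, b, c.  In particular
-- ∑ f a (a - 1) = 0.  The extension is needed because r₂′ - r₁′ can be as low
-- as -3 even when r₁ ≤ r₂.
∑ : (ℤ → ℚ) → ℤ → ℤ → ℚ
∑ f a b with (b - a) + 1ℤ
... | + n      = sumFrom f a n
... | -[1+ n ] = ℚ.- sumFrom f (b + 1ℤ) (suc n)

S : (s₁ s₂ s₃ s₄ s₅ : ℤ) .{{_ : NonZero s₅}} → ℚ
S s₁ s₂ s₃ s₄ s₅ = ∑ (λ x → frac ((s₃ + s₄ * x) ÷ᶻ s₅) ℚ.* ι s₅) s₁ s₂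

module Formula (r₁ r₂ r₃ r₅ g₁ : ℤ) .{{_ : NonZero r₅}} .{{_ : NonZero g₁}} where

  r₁′ r₂′ : ℤ
  r₁′ = floor ((r₃ + g₁ * r₁) ÷ᶻ r₅) + + 2
  r₂′ = floor ((r₃ + g₁ * r₂) ÷ᶻ r₅) - 1ℤ

  d : ℤ
  d = gcd r₅ g₁

  d-nonZero : NonZero d
  d-nonZero =
    ℕ.≢-nonZero (ℕ.gcd[m,n]≢0 ∣ r₅ ∣ ∣ g₁ ∣ (inj₂ (ℕ.≢-nonZero⁻¹ ∣ g₁ ∣)))

  r₅/d : ℤ
  r₅/d = (r₅ / d) {{d-nonZero}}

  -- For r₅ > 0 we have g₁ > 0 and m = g₁ / d.  When r₅ < 0 also g₁ < 0, and
  -- the absolute value makes the modulus m positive, so that frac (y / m) * m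
  -- is still the residue of y in [0, m).
  m : ℤ
  m = (+ ∣ g₁ ∣ / d) {{d-nonZero}}

  m-nonZero : NonZero m
  m-nonZero = subst NonZero (sym (ℤ.*-identityˡ (+ (∣ g₁ ∣ ℕ./ ∣ d ∣))))
    (ℕ.≢-nonZero (ℕ.n/gcd[m,n]≢0 ∣ r₅ ∣ ∣ g₁ ∣))
    where
    instance
      _ : ℕ.NonZero ∣ d ∣
      _ = d-nonZero

  -- u inverts r₅ / d modulo g₁ / d; the sign of the modulus is immaterial here.
  IsInverse : ℤ → Set
  IsInverse u = m ∣ (u * r₅/d - 1ℤ)

  -- Only used when d ∣ r₃, where the integer quotient r₃ / d is exact.
  r : ℤ → ℚ
  r u = frac (((r₃/d - (r₁′ - 1ℤ) * r₅/d) * u ÷ᶻ m) {{m-nonZero}}) ℚ.* ι m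
    where
    r₃/d : ℤ
    r₃/d = (r₃ / d) {{d-nonZero}}

  q : ℤ → ℤ
  q u = if does (d ∣? r₃)
    then floor (((ι (r₂′ - r₁′ + + 2) ℚ.- r u) ℚ.÷ ι m) {{ι-nonZero m {{m-nonZero}}}}) + 1ℤ
    else 0ℤ

  A : ℤ → ℚ
  A u =
    ι ((r₂ - r₁ + 1ℤ) * r₃)
      ℚ.+ (g₁ ℚ./ 2) ℚ.* ι ((r₂ + r₁) * (r₂ - r₁ + 1ℤ))
      ℚ.- ι r₅ ℚ.*
        (ι (- floor (((r₁′ - 1ℤ) * r₅ - r₃) ÷ᶻ g₁)
             + (r₁′ - + 2) * (- r₁ + 1ℤ)
             + q u
             - floor (((r₂′ + 1ℤ) * r₅ - r₃) ÷ᶻ g₁)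
             + (r₂′ + 1ℤ) * r₂)
          ℚ.+ (r₃ ÷ᶻ g₁) ℚ.* ι (r₂′ - r₁′ + 1ℤ)
          ℚ.- (r₅ ÷ᶻ (+ 2 * g₁)) {{ℤ.i*j≢0 (+ 2) g₁}} ℚ.* ι ((r₂′ + r₁′) * (r₂′ - r₁′ + 1ℤ)))

{-# OPTIONS --safe #-}

-- With F x = ⌊(r₃ + g₁ x) / r₅⌋ and G j = ⌊(j r₅ - r₃) / g₁⌋, each fractional
-- part sum is an arithmetic progression sum minus a multiple of ∑ F or ∑ G, so
-- the theorem amounts to a closed form for ∑ F + ∑ G: the two families of floors
-- count the lattice points on either side of a line.  It is proved by letting
-- r₂ vary.  Since 0 < g₁ / r₅ < 1, F (x + 1) is F x or F x + 1.  In the first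
-- case only the F-sum changes; in the second j = F x + 1 is a new index on the
-- G side, and G j = x unless g₁ divides j r₅ - r₃, when G j = x + 1.
-- The correction q counts exactly these exceptional j.  With oriented sums the
-- step can also be taken backwards, which covers r₂ < r₁.
module Submission where

open import Defs
import Algebra.Properties.Group as Group
open import Data.Bool.Base using (if_then_else_; true; false)
open import Data.Integer.Base as ℤ using (ℤ; +_; -[1+_]; +[1+_]; 0ℤ; 1ℤ; NonZero)
open import Data.Integer.Divisibility.Signed
import Data.Integer.DivMod as ℤ
import Data.Integer.GCD as ℤ
import Data.Integer.Properties as ℤ
import Data.Integer.Tactic.RingSolver as ℤ
open import Data.Nat.Base as ℕ using (zero; suc)
open import Data.Nat.Coprimality using (1-coprimeTo) renaming (sym to coprime-sym)
import Data.Nat.Divisibility as ℕ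
open import Data.Rational.Base as ℚ
  using (ℚ; mkℚ; 0ℚ; 1ℚ; ½; floor; *≤*; *<*; _+_; _*_; -_; _-_; _≤_; _<_)
import Data.Rational.Properties as ℚ
open import Data.Sum.Base using (_⊎_; inj₁; inj₂)
open import Function.Base using (_∘_)
open import Function.Bundles using (_⇔_; mk⇔)
open import Level using (0ℓ)
open import Relation.Binary.PropositionalEquality
open import Relation.Nullary.Decidable
  using (Dec; does; yes; no; dec⇒maybe; dec-true; dec-false; does-⇔)
open import Relation.Nullary.Negation using (¬_; contradiction)
open import Tactic.RingSolver using (solve-∀)
open import Tactic.RingSolver.Core.AlmostCommutativeRing
  using (AlmostCommutativeRing; fromCommutativeRing)

-- The embedding of the integers in the rationals.

ℚ-ring : AlmostCommutativeRing 0ℓ 0ℓ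
ℚ-ring = fromCommutativeRing ℚ.+-*-commutativeRing λ p → dec⇒maybe (0ℚ ℚ.≟ p)

-- `ι i` normalises by a gcd that does not reduce for a variable `i`. Rewriting to this constructor
-- form lets sums, products and comparisons compute.
ι-mkℚ : ∀ i → ι i ≡ mkℚ i 0 (coprime-sym (1-coprimeTo ℤ.∣ i ∣))
ι-mkℚ i = ℚ.fromℚᵘ-toℚᵘ (mkℚ i 0 (coprime-sym (1-coprimeTo ℤ.∣ i ∣)))

ι-+ : ∀ i j → ι (i ℤ.+ j) ≡ ι i + ι j
ι-+ i j rewrite ι-mkℚ i | ι-mkℚ j =
  cong ι (cong₂ ℤ._+_ (sym (ℤ.*-identityʳ i)) (sym (ℤ.*-identityʳ j)))

ι-* : ∀ i j → ι (i ℤ.* j) ≡ ι i * ι j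
ι-* i j rewrite ι-mkℚ i | ι-mkℚ j = refl

ι-neg : ∀ i → ι (ℤ.- i) ≡ - ι i
ι-neg (+ 0)    = refl
ι-neg +[1+ n ] = refl
ι-neg -[1+ n ] = sym (Group.⁻¹-involutive ℚ.+-0-group (ι +[1+ n ]))

ι-- : ∀ i j → ι (i ℤ.- j) ≡ ι i - ι j
ι-- i j = trans (ι-+ i (ℤ.- j)) (cong (_+_ (ι i)) (ι-neg j))

ι-mono-≤ : ∀ {i j} → i ℤ.≤ j → ι i ≤ ι j
ι-mono-≤ {i} {j} i≤j rewrite ι-mkℚ i | ι-mkℚ j = *≤* (ℤ.*-monoʳ-≤-nonNeg 1ℤ i≤j)

ι-mono-< : ∀ {i j} → i ℤ.< j → ι i < ι j
ι-mono-< {i} {j} i<j rewrite ι-mkℚ i | ι-mkℚ j = *<* (ℤ.*-monoʳ-<-pos 1ℤ i<j)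

ι-cancel-≤ : ∀ {i j} → ι i ≤ ι j → i ℤ.≤ j
ι-cancel-≤ ιi≤ιj = ℤ.≮⇒≥ λ j<i → ℚ.<-irrefl refl (ℚ.<-≤-trans (ι-mono-< j<i) ιi≤ιj)

ι-cancel-< : ∀ {i j} → ι i < ι j → i ℤ.< j
ι-cancel-< ιi<ιj = ℤ.≰⇒> λ j≤i → ℚ.<-irrefl refl (ℚ.<-≤-trans ιi<ιj (ι-mono-≤ j≤i))

ι-injective : ∀ {i j} → ι i ≡ ι j → i ≡ j
ι-injective eq = ℤ.≤-antisym (ι-cancel-≤ (ℚ.≤-reflexive eq)) (ι-cancel-≤ (ℚ.≤-reflexive (sym eq)))

÷ᶻ-* : ∀ i j .{{_ : NonZero j}} → (i ÷ᶻ j) * ι j ≡ ι i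
÷ᶻ-* i j = trans (ℚ.*-assoc (ι i) _ (ι j))
  (trans (cong (ι i *_) (ℚ.*-inverseˡ (ι j) {{ι-nonZero j}})) (ℚ.*-identityʳ (ι i)))

÷ᶻ-unique : ∀ {p} i j .{{_ : NonZero j}} → p * ι j ≡ ι i → i ÷ᶻ j ≡ p
÷ᶻ-unique {p} i j eq = trans (cong (_* _) (sym eq)) (trans (ℚ.*-assoc p (ι j) _)
  (trans (cong (p *_) (ℚ.*-inverseʳ (ι j) {{ι-nonZero j}})) (ℚ.*-identityʳ p)))

-- Floors, fractional parts and indicators.

floor-≤ : ∀ p → ι (floor p) ≤ p
floor-≤ p@record{} rewrite ι-mkℚ (floor p) =
  *≤* (subst (floor p ℤ.* ℚ.↧ p ℤ.≤_) (sym (ℤ.*-identityʳ (ℚ.↥ p)))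
    (ℤ.[n/d]*d≤n (ℚ.↥ p) (ℚ.↧ p)))

floor-< : ∀ p → p < ι (floor p ℤ.+ 1ℤ)
floor-< p@(mkℚ n d-1 _) rewrite ι-mkℚ (floor p ℤ.+ 1ℤ) = *<* (begin-strict
  n ℤ.* 1ℤ                              ≡⟨ ℤ.*-identityʳ n ⟩
  n                                     <⟨ ℤ.n<s[n/ℕd]*d n (suc d-1) ⟩
  ℤ.suc (n ℤ./ℕ suc d-1) ℤ.* + suc d-1  ≡⟨ cong (ℤ._* + suc d-1) (ℤ.+-comm 1ℤ (n ℤ./ℕ suc d-1)) ⟩
  (n ℤ./ℕ suc d-1 ℤ.+ 1ℤ) ℤ.* + suc d-1
    ≡⟨ cong (λ k → (k ℤ.+ 1ℤ) ℤ.* + suc d-1) (ℤ.div-pos-is-/ℕ n (suc d-1)) ⟨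
  (floor p ℤ.+ 1ℤ) ℤ.* + suc d-1        ∎)
  where open ℤ.≤-Reasoning

i<i+1 : ∀ i → i ℤ.< i ℤ.+ 1ℤ
i<i+1 i = ℤ.≤-<-trans (ℤ.≤-reflexive (sym (ℤ.+-identityʳ i))) (ℤ.+-monoʳ-< i (ℤ.+<+ ℕ.z<s))

<+1⇒≤ : ∀ {i j} → i ℤ.< j ℤ.+ 1ℤ → i ℤ.≤ j
<+1⇒≤ {i} {j} i<j+1 = subst (i ℤ.≤_)
  (trans (cong ℤ.pred (ℤ.+-comm j 1ℤ)) (ℤ.pred-suc j)) (ℤ.i<j⇒i≤pred[j] i<j+1)

<⇒+1≤ : ∀ {i j} → i ℤ.< j → i ℤ.+ 1ℤ ℤ.≤ j
<⇒+1≤ {i} {j} i<j = subst (ℤ._≤ j) (ℤ.+-comm 1ℤ i) (ℤ.i<j⇒suc[i]≤j i<j)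

floor-unique : ∀ {p} k → ι k ≤ p → p < ι (k ℤ.+ 1ℤ) → floor p ≡ k
floor-unique {p} k k≤p p<k+1 = ℤ.≤-antisym
  (<+1⇒≤ (ι-cancel-< {floor p} (ℚ.≤-<-trans (floor-≤ p) p<k+1)))
  (<+1⇒≤ (ι-cancel-< {k} (ℚ.≤-<-trans k≤p (floor-< p))))

floor-+ι : ∀ p k → floor (p + ι k) ≡ floor p ℤ.+ k
floor-+ι p k = floor-unique _
  (subst (_≤ p + ι k) (sym (ι-+ (floor p) k)) (ℚ.+-monoˡ-≤ (ι k) (floor-≤ p)))
  (subst (p + ι k <_) lemma (ℚ.+-monoˡ-< (ι k) (floor-< p)))
  where
  lemma : ι (floor p ℤ.+ 1ℤ) + ι k ≡ ι (floor p ℤ.+ k ℤ.+ 1ℤ)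
  lemma = trans (sym (ι-+ (floor p ℤ.+ 1ℤ) k)) (cong ι (swap (floor p) k))
    where
    swap : ∀ i j → i ℤ.+ 1ℤ ℤ.+ j ≡ i ℤ.+ j ℤ.+ 1ℤ
    swap = ℤ.solve-∀

frac-+ι : ∀ p k → frac (p + ι k) ≡ frac p
frac-+ι p k rewrite floor-+ι p k | ι-+ (floor p) k = cancel p (ι k) (ι (floor p))
  where
  cancel : ∀ x y z → x + y - (z + y) ≡ x - z
  cancel = solve-∀ ℚ-ring

0≤frac : ∀ p → 0ℚ ≤ frac p
0≤frac p = subst (_≤ frac p) (ℚ.+-inverseʳ (ι (floor p))) (ℚ.+-monoˡ-≤ (- ι (floor p)) (floor-≤ p))

frac<1 : ∀ p → frac p < 1ℚ
frac<1 p = subst (frac p <_) lemma (ℚ.+-monoˡ-< (- ι (floor p)) (floor-< p))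
  where
  cancel : ∀ x → x + 1ℚ - x ≡ 1ℚ
  cancel = solve-∀ ℚ-ring
  lemma : ι (floor p ℤ.+ 1ℤ) - ι (floor p) ≡ 1ℚ
  lemma = trans (cong (_- ι (floor p)) (ι-+ (floor p) 1ℤ)) (cancel (ι (floor p)))

-- Only `does` enters, so equivalent propositions get equal indicators through `does-⇔`.
𝟙 : ∀ {p} {P : Set p} → Dec P → ℤ
𝟙 P? = if does P? then 1ℤ else 0ℤ

𝟙-true : ∀ {p} {P : Set p} (P? : Dec P) → P → 𝟙 P? ≡ 1ℤ
𝟙-true P? p = cong (if_then 1ℤ else 0ℤ) (dec-true P? p)

𝟙-false : ∀ {p} {P : Set p} (P? : Dec P) → ¬ P → 𝟙 P? ≡ 0ℤ
𝟙-false P? ¬p = cong (if_then 1ℤ else 0ℤ) (dec-false P? ¬p)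

floor-ι : ∀ k → floor (ι k) ≡ k
floor-ι k = floor-unique k ℚ.≤-refl (ι-mono-< (i<i+1 k))

-- On (k, k + 1] the floor is ⌈ · ⌉ - 1 = k, except at the integer k + 1.
floor-÷ᶻ : ∀ i j k .{{_ : NonZero j}} → ι k < i ÷ᶻ j → i ÷ᶻ j ≤ ι (k ℤ.+ 1ℤ) →
  floor (i ÷ᶻ j) ≡ k ℤ.+ 𝟙 (j ∣? i)
floor-÷ᶻ i j k k<i/j i/j≤k+1 with j ∣? i
... | yes (divides c i≡cj) = begin
  floor (i ÷ᶻ j)  ≡⟨ cong floor i/j≡c ⟩
  floor (ι c)     ≡⟨ floor-ι c ⟩
  c               ≡⟨ ℤ.≤-antisym
                       (ι-cancel-≤ (subst (_≤ ι (k ℤ.+ 1ℤ)) i/j≡c i/j≤k+1))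
                       (<⇒+1≤ (ι-cancel-< {k} (subst (ι k <_) i/j≡c k<i/j))) ⟩
  k ℤ.+ 1ℤ        ≡⟨ cong (ℤ._+_ k) (𝟙-true (j ∣? i) (divides c i≡cj)) ⟨
  k ℤ.+ 𝟙 (j ∣? i) ∎
  where
  open ≡-Reasoning
  i/j≡c : i ÷ᶻ j ≡ ι c
  i/j≡c = ÷ᶻ-unique i j (trans (sym (ι-* c j)) (cong ι (sym i≡cj)))
... | no j∤i = trans (floor-unique {i ÷ᶻ j} k (ℚ.<⇒≤ k<i/j) (ℚ.≰⇒> λ k+1≤i/j →
    j∤i (divides (k ℤ.+ 1ℤ) (ι-injective {i} (begin
      ι i                          ≡⟨ ÷ᶻ-* i j ⟨
      (i ÷ᶻ j) * ι j               ≡⟨ cong (_* ι j) (ℚ.≤-antisym i/j≤k+1 k+1≤i/j) ⟩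
      ι (k ℤ.+ 1ℤ) * ι j           ≡⟨ ι-* (k ℤ.+ 1ℤ) j ⟨
      ι ((k ℤ.+ 1ℤ) ℤ.* j)         ∎)))))
  (sym (trans (cong (ℤ._+_ k) (𝟙-false (j ∣? i) j∤i)) (ℤ.+-identityʳ k)))
  where open ≡-Reasoning

-- Induction over the integers and oriented sums.

-- Below zero the same step is read backwards. This replaces every case split on the sign of an
-- integer or on the order of two bounds once a forward step is known.
+1-invariant : ∀ {a} {A : Set a} (D : ℤ → A) → (∀ i → D (i ℤ.+ 1ℤ) ≡ D i) → ∀ i j → D i ≡ D j
+1-invariant D D-step i j = trans (D≡D0 i) (sym (D≡D0 j))
  where
  D-suc : ∀ i → D (ℤ.suc i) ≡ D i
  D-suc i = trans (cong D (ℤ.+-comm 1ℤ i)) (D-step i)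
  D≡D0 : ∀ i → D i ≡ D 0ℤ
  D≡D0 (+ zero)     = refl
  D≡D0 (+ suc n)    = trans (D-suc (+ n)) (D≡D0 (+ n))
  D≡D0 -[1+ zero  ] = sym (D-suc -[1+ 0 ])
  D≡D0 -[1+ suc n ] = trans (sym (D-suc -[1+ suc n ])) (D≡D0 -[1+ n ])

module _ (f : ℤ → ℚ) where

  sumFrom-snoc : ∀ a n → sumFrom f a (suc n) ≡ sumFrom f a n + f (a ℤ.+ + n)
  sumFrom-snoc a zero    = trans (ℚ.+-comm (f a) 0ℚ) (cong (λ i → 0ℚ + f i) (sym (ℤ.+-identityʳ a)))
  sumFrom-snoc a (suc n) = trans
    (cong (_+_ (f a)) (trans (sumFrom-snoc (a ℤ.+ 1ℤ) n)
      (cong (λ i → sumFrom f (a ℤ.+ 1ℤ) n + f i) (ℤ.+-assoc a 1ℤ (+ n)))))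
    (sym (ℚ.+-assoc (f a) _ _))

  ∑-nonNeg : ∀ {a b n} → b ℤ.- a ℤ.+ 1ℤ ≡ + n → ∑ f a b ≡ sumFrom f a n
  ∑-nonNeg eq rewrite eq = refl

  ∑-neg : ∀ {a b n} → b ℤ.- a ℤ.+ 1ℤ ≡ -[1+ n ] → ∑ f a b ≡ - sumFrom f (b ℤ.+ 1ℤ) (suc n)
  ∑-neg eq rewrite eq = refl

  ∑-empty : ∀ a → ∑ f a (a ℤ.- 1ℤ) ≡ 0ℚ
  ∑-empty a = ∑-nonNeg {a} {a ℤ.- 1ℤ} {0} (lemma a)
    where
    lemma : ∀ a → a ℤ.- 1ℤ ℤ.- a ℤ.+ 1ℤ ≡ 0ℤ
    lemma = ℤ.solve-∀

  -- For `b + 1 < a` the sum carries a minus sign, and moving the upper bound up removes the term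
  -- `f (b + 1)` from it; at length -1 that term is the only one.
  ∑-step : ∀ a b → ∑ f a (b ℤ.+ 1ℤ) ≡ ∑ f a b + f (b ℤ.+ 1ℤ)
  ∑-step a b = go (b ℤ.- a ℤ.+ 1ℤ) refl
    where
    length-step : ∀ a b → b ℤ.+ 1ℤ ℤ.- a ℤ.+ 1ℤ ≡ b ℤ.- a ℤ.+ 1ℤ ℤ.+ 1ℤ
    length-step = ℤ.solve-∀
    end : ∀ a b → a ℤ.+ (b ℤ.- a ℤ.+ 1ℤ) ≡ b ℤ.+ 1ℤ
    end = ℤ.solve-∀
    cancel₁ : ∀ x → 0ℚ ≡ - (x + 0ℚ) + x
    cancel₁ = solve-∀ ℚ-ring
    cancel₂ : ∀ x y → - y ≡ - (x + y) + x
    cancel₂ = solve-∀ ℚ-ring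
    go : ∀ k → b ℤ.- a ℤ.+ 1ℤ ≡ k → ∑ f a (b ℤ.+ 1ℤ) ≡ ∑ f a b + f (b ℤ.+ 1ℤ)
    go (+ n) eq = begin
      ∑ f a (b ℤ.+ 1ℤ)
        ≡⟨ ∑-nonNeg {a} {b ℤ.+ 1ℤ} (trans (length-step a b)
          (trans (cong (ℤ._+ 1ℤ) eq) (ℤ.+-comm (+ n) 1ℤ))) ⟩
      sumFrom f a (suc n)           ≡⟨ sumFrom-snoc a n ⟩
      sumFrom f a n + f (a ℤ.+ + n)
        ≡⟨ cong₂ _+_ (sym (∑-nonNeg {a} {b} eq)) (cong f (trans (cong (ℤ._+_ a) (sym eq)) (end a b))) ⟩
      ∑ f a b + f (b ℤ.+ 1ℤ)        ∎
      where open ≡-Reasoning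
    go -[1+ zero ] eq = begin
      ∑ f a (b ℤ.+ 1ℤ)
        ≡⟨ ∑-nonNeg {a} {b ℤ.+ 1ℤ} (trans (length-step a b) (cong (ℤ._+ 1ℤ) eq)) ⟩
      0ℚ                                      ≡⟨ cancel₁ (f (b ℤ.+ 1ℤ)) ⟩
      - sumFrom f (b ℤ.+ 1ℤ) 1 + f (b ℤ.+ 1ℤ) ≡⟨ cong (_+ f (b ℤ.+ 1ℤ)) (∑-neg {a} {b} eq) ⟨
      ∑ f a b + f (b ℤ.+ 1ℤ)                  ∎
      where open ≡-Reasoning
    go -[1+ suc n ] eq = begin
      ∑ f a (b ℤ.+ 1ℤ)
        ≡⟨ ∑-neg {a} {b ℤ.+ 1ℤ} (trans (length-step a b) (cong (ℤ._+ 1ℤ) eq)) ⟩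
      - sumFrom f (b ℤ.+ 1ℤ ℤ.+ 1ℤ) (suc n)               ≡⟨ cancel₂ (f (b ℤ.+ 1ℤ)) _ ⟩
      - sumFrom f (b ℤ.+ 1ℤ) (suc (suc n)) + f (b ℤ.+ 1ℤ)
        ≡⟨ cong (_+ f (b ℤ.+ 1ℤ)) (∑-neg {a} {b} eq) ⟨
      ∑ f a b + f (b ℤ.+ 1ℤ)                              ∎
      where open ≡-Reasoning

  -- The difference `∑ f a b - P b` is unchanged by `b ↦ b + 1` and is zero at `b = a - 1`. A closed
  -- form is thus verified by one value and one step, for both orientations.
  ∑-unique : ∀ a (P : ℤ → ℚ) → P (a ℤ.- 1ℤ) ≡ 0ℚ → (∀ b → P (b ℤ.+ 1ℤ) ≡ P b + f (b ℤ.+ 1ℤ)) →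
    ∀ b → ∑ f a b ≡ P b
  ∑-unique a P P-empty P-step b = begin
    ∑ f a b                                               ≡⟨ restore (∑ f a b) (P b) ⟨
    ∑ f a b - P b + P b
      ≡⟨ cong (_+ P b) (+1-invariant (λ b → ∑ f a b - P b) invariant b (a ℤ.- 1ℤ)) ⟩
    ∑ f a (a ℤ.- 1ℤ) - P (a ℤ.- 1ℤ) + P b
      ≡⟨ cong₂ (λ x y → x - y + P b) (∑-empty a) P-empty ⟩
    0ℚ - 0ℚ + P b                                         ≡⟨ ℚ.+-identityˡ (P b) ⟩
    P b                                                   ∎
    where
    open ≡-Reasoning
    restore : ∀ x y → x - y + y ≡ x
    restore = solve-∀ ℚ-ring
    cancel : ∀ x y z → x + z - (y + z) ≡ x - y
    cancel = solve-∀ ℚ-ring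
    invariant : ∀ b → ∑ f a (b ℤ.+ 1ℤ) - P (b ℤ.+ 1ℤ) ≡ ∑ f a b - P b
    invariant b = trans (cong₂ _-_ (∑-step a b) (P-step b)) (cancel (∑ f a b) (P b) (f (b ℤ.+ 1ℤ)))

∑-cong : ∀ {f g} → (∀ x → f x ≡ g x) → ∀ a b → ∑ f a b ≡ ∑ g a b
∑-cong {f} {g} f≗g a = ∑-unique f a (∑ g a) (∑-empty g a)
  (λ b → trans (∑-step g a b) (cong (_+_ (∑ g a b)) (sym (f≗g (b ℤ.+ 1ℤ)))))

-- The factor with `½` is Gauss's formula for the sum of the integers from `a` to `b`. Its double
-- `t` grows by `2 (b + 1)` at each step, so no halving in ℤ occurs.
∑-linear : ∀ c e p (f : ℤ → ℚ) a b →
  ∑ (λ x → ι (c ℤ.+ e ℤ.* x) - p * f x) a b ≡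
    ι (b ℤ.- a ℤ.+ 1ℤ) * ι c + ι e * (½ * ι ((b ℤ.+ a) ℤ.* (b ℤ.- a ℤ.+ 1ℤ))) - p * ∑ f a b
∑-linear c e p f a = ∑-unique _ a P P-empty P-step
  where
  open ≡-Reasoning
  n t : ℤ → ℤ
  n b = b ℤ.- a ℤ.+ 1ℤ
  t b = (b ℤ.+ a) ℤ.* n b
  P : ℤ → ℚ
  P b = ι (n b) * ι c + ι e * (½ * ι (t b)) - p * ∑ f a b
  P-empty : P (a ℤ.- 1ℤ) ≡ 0ℚ
  P-empty = begin
    P (a ℤ.- 1ℤ)
      ≡⟨ cong (λ s → ι (n (a ℤ.- 1ℤ)) * ι c + ι e * (½ * ι (t (a ℤ.- 1ℤ))) - p * s)
           (∑-empty f a) ⟩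
    ι (n (a ℤ.- 1ℤ)) * ι c + ι e * (½ * ι (t (a ℤ.- 1ℤ))) - p * 0ℚ
      ≡⟨ cong₂ (λ i j → ι i * ι c + ι e * (½ * ι j) - p * 0ℚ) (n-empty a) (t-empty a) ⟩
    0ℚ * ι c + ι e * 0ℚ - p * 0ℚ ≡⟨ vanish (ι c) (ι e) p ⟩
    0ℚ                                  ∎
    where
    n-empty : ∀ a → a ℤ.- 1ℤ ℤ.- a ℤ.+ 1ℤ ≡ 0ℤ
    n-empty = ℤ.solve-∀
    t-empty : ∀ a → (a ℤ.- 1ℤ ℤ.+ a) ℤ.* (a ℤ.- 1ℤ ℤ.- a ℤ.+ 1ℤ) ≡ 0ℤ
    t-empty = ℤ.solve-∀
    vanish : ∀ x y z → 0ℚ * x + y * 0ℚ - z * 0ℚ ≡ 0ℚ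
    vanish = solve-∀ ℚ-ring
  P-step : ∀ b → P (b ℤ.+ 1ℤ) ≡ P b + (ι (c ℤ.+ e ℤ.* (b ℤ.+ 1ℤ)) - p * f (b ℤ.+ 1ℤ))
  P-step b = begin
    P (b ℤ.+ 1ℤ)
      ≡⟨ cong (λ s → ι (n (b ℤ.+ 1ℤ)) * ι c + ι e * (½ * ι (t (b ℤ.+ 1ℤ))) - p * s) (∑-step f a b) ⟩
    ι (n (b ℤ.+ 1ℤ)) * ι c + ι e * (½ * ι (t (b ℤ.+ 1ℤ))) - p * (∑ f a b + f (b ℤ.+ 1ℤ))
      ≡⟨ cong₂ (λ i j → i * ι c + ι e * (½ * j) - p * (∑ f a b + f (b ℤ.+ 1ℤ)))
           (trans (cong ι (n-step a b)) (ι-+ (n b) 1ℤ))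
           (trans (cong ι (t-step a b)) (trans (ι-+ (t b) _)
             (cong (_+_ (ι (t b))) (ι-+ (b ℤ.+ 1ℤ) (b ℤ.+ 1ℤ))))) ⟩
    (ι (n b) + 1ℚ) * ι c + ι e * (½ * (ι (t b) + (ι (b ℤ.+ 1ℤ) + ι (b ℤ.+ 1ℤ))))
      - p * (∑ f a b + f (b ℤ.+ 1ℤ))
      ≡⟨ identity (ι (n b)) (ι c) (ι e) (ι (t b)) (ι (b ℤ.+ 1ℤ)) p (∑ f a b) (f (b ℤ.+ 1ℤ)) ⟩
    P b + (ι c + ι e * ι (b ℤ.+ 1ℤ) - p * f (b ℤ.+ 1ℤ))
      ≡⟨ cong (λ x → P b + (x - p * f (b ℤ.+ 1ℤ)))
           (trans (ι-+ c (e ℤ.* (b ℤ.+ 1ℤ))) (cong (_+_ (ι c)) (ι-* e (b ℤ.+ 1ℤ)))) ⟨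
    P b + (ι (c ℤ.+ e ℤ.* (b ℤ.+ 1ℤ)) - p * f (b ℤ.+ 1ℤ)) ∎
    where
    n-step : ∀ a b → b ℤ.+ 1ℤ ℤ.- a ℤ.+ 1ℤ ≡ b ℤ.- a ℤ.+ 1ℤ ℤ.+ 1ℤ
    n-step = ℤ.solve-∀
    t-step : ∀ a b → (b ℤ.+ 1ℤ ℤ.+ a) ℤ.* (b ℤ.+ 1ℤ ℤ.- a ℤ.+ 1ℤ) ≡
      (b ℤ.+ a) ℤ.* (b ℤ.- a ℤ.+ 1ℤ) ℤ.+ ((b ℤ.+ 1ℤ) ℤ.+ (b ℤ.+ 1ℤ))
    t-step = ℤ.solve-∀
    identity : ∀ n c e t x p s y →
      (n + 1ℚ) * c + e * (½ * (t + (x + x))) - p * (s + y) ≡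
      n * c + e * (½ * t) - p * s + (c + e * x - p * y)
    identity = solve-∀ ℚ-ring

-- Arithmetic of integer quotients.

÷ᶻ-+ : ∀ i j k .{{_ : NonZero k}} → (i ℤ.+ j) ÷ᶻ k ≡ i ÷ᶻ k + j ÷ᶻ k
÷ᶻ-+ i j k = trans (cong (λ p → p * _) (ι-+ i j)) (ℚ.*-distribʳ-+ _ (ι i) (ι j))

*-distribʳ-- : ∀ p q r → (p - q) * r ≡ p * r - q * r
*-distribʳ-- = solve-∀ ℚ-ring

÷ᶻ-- : ∀ i j k .{{_ : NonZero k}} → (i ℤ.- j) ÷ᶻ k ≡ i ÷ᶻ k - j ÷ᶻ k
÷ᶻ-- i j k = trans (cong (λ p → p * _) (ι-- i j)) (*-distribʳ-- (ι i) (ι j) _)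

*-÷ᶻ : ∀ i k .{{_ : NonZero k}} → (i ℤ.* k) ÷ᶻ k ≡ ι i
*-÷ᶻ i k = ÷ᶻ-unique (i ℤ.* k) k (sym (ι-* i k))

-- Serves the summands of `S`, the number `r` and `g₁` alike: each is an integer remainder, so
-- integer arithmetic applies to it.
frac-÷ᶻ-* : ∀ i j .{{_ : NonZero j}} → frac (i ÷ᶻ j) * ι j ≡ ι (i ℤ.- floor (i ÷ᶻ j) ℤ.* j)
frac-÷ᶻ-* i j = begin
  (i ÷ᶻ j - ι k) * ι j        ≡⟨ *-distribʳ-- (i ÷ᶻ j) (ι k) (ι j) ⟩
  (i ÷ᶻ j) * ι j - ι k * ι j  ≡⟨ cong₂ _-_ (÷ᶻ-* i j) (sym (ι-* k j)) ⟩
  ι i - ι (k ℤ.* j)           ≡⟨ ι-- i (k ℤ.* j) ⟨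
  ι (i ℤ.- k ℤ.* j)           ∎
  where
  open ≡-Reasoning
  k : ℤ
  k = floor (i ÷ᶻ j)

-- The floors of a line with slope between 0 and 1.

module Staircase (c e k : ℤ) .{{_ : NonZero e}} .{{_ : NonZero k}}
  (0<e/k : 0ℚ < e ÷ᶻ k) (e/k<1 : e ÷ᶻ k < 1ℚ) where

  z : ℤ → ℚ
  z y = (c ℤ.+ e ℤ.* y) ÷ᶻ k

  z-step : ∀ y → z (y ℤ.+ 1ℤ) ≡ z y + e ÷ᶻ k
  z-step y = trans (cong (_÷ᶻ k) (lemma c e y)) (÷ᶻ-+ (c ℤ.+ e ℤ.* y) e k)
    where
    lemma : ∀ c e y → c ℤ.+ e ℤ.* (y ℤ.+ 1ℤ) ≡ c ℤ.+ e ℤ.* y ℤ.+ e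
    lemma = ℤ.solve-∀

  stair : ℤ → ℤ
  stair y = floor (z y)

  -- A positive slope excludes a descent and a slope below 1 excludes skipping a level; the case is
  -- decided by whether the line has reached `stair y + 1`.
  stair-step : ∀ y → stair (y ℤ.+ 1ℤ) ≡ stair y ⊎ stair (y ℤ.+ 1ℤ) ≡ stair y ℤ.+ 1ℤ
  stair-step y with z (y ℤ.+ 1ℤ) ℚ.<? ι (stair y ℤ.+ 1ℤ)
  ... | yes below = inj₁ (floor-unique {z (y ℤ.+ 1ℤ)} (stair y)
          (ℚ.≤-trans (floor-≤ (z y)) z≤z′) below)
    where
    z≤z′ : z y ≤ z (y ℤ.+ 1ℤ)
    z≤z′ = subst₂ _≤_ (ℚ.+-identityʳ (z y)) (sym (z-step y)) (ℚ.+-monoʳ-≤ (z y) (ℚ.<⇒≤ 0<e/k))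
  ... | no ¬below = inj₂ (floor-unique {z (y ℤ.+ 1ℤ)} (stair y ℤ.+ 1ℤ) (ℚ.≮⇒≥ ¬below)
          (subst₂ _<_ (sym (z-step y)) (sym (ι-+ (stair y ℤ.+ 1ℤ) 1ℤ)) (ℚ.+-mono-< (floor-< (z y)) e/k<1)))

  -- If j is attained at y + 1 but not at y, then y < (j k - c) / e ≤ y + 1.
  stair-inverse : ∀ y → stair (y ℤ.+ 1ℤ) ≡ stair y ℤ.+ 1ℤ →
    let n = (stair y ℤ.+ 1ℤ) ℤ.* k ℤ.- c in floor (n ÷ᶻ e) ≡ y ℤ.+ 𝟙 (e ∣? n)
  stair-inverse y jump = floor-÷ᶻ n e y
    -- The sign of `e` is unknown, so both bounds are multiplied by the positive slope `e ÷ᶻ k`.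
    -- After adding `c ÷ᶻ k` they read `z y < j ≤ z (y + 1)`.
    (ℚ.*-cancelʳ-<-nonNeg (e ÷ᶻ k) {{ℚ.nonNegative (ℚ.<⇒≤ 0<e/k)}} (begin-strict
      ι y * (e ÷ᶻ k)        ≡⟨ y*e/k y ⟩
      z y - c ÷ᶻ k          <⟨ ℚ.+-monoˡ-< (- (c ÷ᶻ k)) (floor-< (z y)) ⟩
      ι j - c ÷ᶻ k          ≡⟨ n/e*e/k ⟨
      (n ÷ᶻ e) * (e ÷ᶻ k)   ∎))
    (ℚ.*-cancelʳ-≤-pos (e ÷ᶻ k) {{ℚ.positive 0<e/k}} (begin
      (n ÷ᶻ e) * (e ÷ᶻ k)            ≡⟨ n/e*e/k ⟩
      ι j - c ÷ᶻ k                   ≡⟨ cong (λ i → ι i - c ÷ᶻ k) jump ⟨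
      ι (stair (y ℤ.+ 1ℤ)) - c ÷ᶻ k  ≤⟨ ℚ.+-monoˡ-≤ (- (c ÷ᶻ k)) (floor-≤ (z (y ℤ.+ 1ℤ))) ⟩
      z (y ℤ.+ 1ℤ) - c ÷ᶻ k          ≡⟨ y*e/k (y ℤ.+ 1ℤ) ⟨
      ι (y ℤ.+ 1ℤ) * (e ÷ᶻ k)        ∎))
    where
    open ℚ.≤-Reasoning
    j n : ℤ
    j = stair y ℤ.+ 1ℤ
    n = j ℤ.* k ℤ.- c
    y*e/k : ∀ y → ι y * (e ÷ᶻ k) ≡ z y - c ÷ᶻ k
    y*e/k y = begin-equality
      ι y * (e ÷ᶻ k)                         ≡⟨ rearrange (ι y) (ι e) _ (c ÷ᶻ k) ⟩
      c ÷ᶻ k + (ι e * ι y) * _ - c ÷ᶻ k      ≡⟨ cong (λ p → c ÷ᶻ k + p * _ - c ÷ᶻ k) (ι-* e y) ⟨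
      c ÷ᶻ k + (e ℤ.* y) ÷ᶻ k - c ÷ᶻ k       ≡⟨ cong (_- c ÷ᶻ k) (÷ᶻ-+ c (e ℤ.* y) k) ⟨
      z y - c ÷ᶻ k                           ∎
      where
      rearrange : ∀ y e w b → y * (e * w) ≡ b + (e * y) * w - b
      rearrange = solve-∀ ℚ-ring
    n/e*e/k : (n ÷ᶻ e) * (e ÷ᶻ k) ≡ ι j - c ÷ᶻ k
    n/e*e/k = begin-equality
      (n ÷ᶻ e) * (ι e * _)         ≡⟨ ℚ.*-assoc (n ÷ᶻ e) (ι e) _ ⟨
      ((n ÷ᶻ e) * ι e) * _         ≡⟨ cong (λ p → p * _) (÷ᶻ-* n e) ⟩
      n ÷ᶻ k                       ≡⟨ ÷ᶻ-- (j ℤ.* k) c k ⟩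
      (j ℤ.* k) ÷ᶻ k - c ÷ᶻ k      ≡⟨ cong (_- c ÷ᶻ k) (*-÷ᶻ j k) ⟩
      ι j - c ÷ᶻ k                 ∎

-- Exact division and floors along consecutive numerators.

∣⇒/*≡ : ∀ {i d} .{{_ : NonZero d}} → d ∣ i → (i ℤ./ d) ℤ.* d ≡ i
∣⇒/*≡ {i} {d} d∣i with i ℤ.% d | ℤ.a≡a%n+[a/n]*n i d | ℤ.n%d<d i d
... | zero  | i≡ | _   = trans (sym (ℤ.+-identityˡ _)) (sym i≡)
-- A nonzero remainder would be a multiple of `d` smaller than `∣ d ∣`.
... | suc r | i≡ | r<d = contradiction
  (∣⇒∣ᵤ (∣m+n∣n⇒∣m {d} {+ suc r} (subst (d ∣_) i≡ d∣i) (∣n⇒∣m*n (i ℤ./ d) ∣-refl))) (ℕ.>⇒∤ r<d)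

-- With `k` the old floor, the new quotient lies in `(k, k + 1]`: it exceeds `n / m ≥ k`, and for
-- integers `n < (k + 1) m` gives `n + 1 ≤ (k + 1) m`. So `floor-÷ᶻ` applies.
floor-÷ᶻ-step : ∀ n m .{{_ : NonZero m}} → 0ℤ ℤ.< m →
  floor ((n ℤ.+ 1ℤ) ÷ᶻ m) ≡ floor (n ÷ᶻ m) ℤ.+ 𝟙 (m ∣? n ℤ.+ 1ℤ)
floor-÷ᶻ-step n m 0<m = floor-÷ᶻ (n ℤ.+ 1ℤ) m k
  (ℚ.≤-<-trans (floor-≤ (n ÷ᶻ m)) (ℚ.*-cancelʳ-<-nonNeg (ι m) {{ℚ.nonNegative (ℚ.<⇒≤ 0<ιm)}}
    (subst₂ _<_ (sym (÷ᶻ-* n m)) (sym (÷ᶻ-* (n ℤ.+ 1ℤ) m)) (ι-mono-< (i<i+1 n)))))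
  (ℚ.*-cancelʳ-≤-pos (ι m) {{ℚ.positive 0<ιm}}
    (subst₂ _≤_ (sym (÷ᶻ-* (n ℤ.+ 1ℤ) m)) (ι-* (k ℤ.+ 1ℤ) m) (ι-mono-≤
      (<⇒+1≤ (ι-cancel-< {n} {(k ℤ.+ 1ℤ) ℤ.* m}
      (subst₂ _<_ (÷ᶻ-* n m) (sym (ι-* (k ℤ.+ 1ℤ) m))
        (ℚ.*-monoˡ-<-pos (ι m) {{ℚ.positive 0<ιm}} (floor-< (n ÷ᶻ m)))))))))
  where
  k : ℤ
  k = floor (n ÷ᶻ m)
  0<ιm : 0ℚ < ι m
  0<ιm = ι-mono-< 0<m

floor-÷ᶻ-<0 : ∀ i m .{{_ : NonZero m}} → 0ℤ ℤ.< m → 0ℤ ℤ.≤ i → i ℤ.< m →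
  floor ((ℤ.- 1ℤ ℤ.- i) ÷ᶻ m) ≡ ℤ.- 1ℤ
floor-÷ᶻ-<0 i m 0<m 0≤i i<m = floor-unique {(ℤ.- 1ℤ ℤ.- i) ÷ᶻ m} (ℤ.- 1ℤ)
  (ℚ.*-cancelʳ-≤-pos (ι m) {{ℚ.positive 0<ιm}}
    (subst₂ _≤_ (ι-* (ℤ.- 1ℤ) m) (sym (÷ᶻ-* (ℤ.- 1ℤ ℤ.- i) m)) (ι-mono-≤ lower)))
  (ℚ.*-cancelʳ-<-nonNeg (ι m) {{ℚ.nonNegative (ℚ.<⇒≤ 0<ιm)}}
    (subst₂ _<_ (sym (÷ᶻ-* (ℤ.- 1ℤ ℤ.- i) m)) (sym (ℚ.*-zeroˡ (ι m))) (ι-mono-< upper)))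
  where
  0<ιm : 0ℚ < ι m
  0<ιm = ι-mono-< 0<m
  lower : ℤ.- 1ℤ ℤ.* m ℤ.≤ ℤ.- 1ℤ ℤ.- i
  lower = subst₂ ℤ._≤_ (sym (ℤ.-1*i≡-i m)) (neg-distrib i) (ℤ.neg-mono-≤ (<⇒+1≤ i<m))
    where
    neg-distrib : ∀ i → ℤ.- (i ℤ.+ 1ℤ) ≡ ℤ.- 1ℤ ℤ.- i
    neg-distrib = ℤ.solve-∀
  upper : ℤ.- 1ℤ ℤ.- i ℤ.< 0ℤ
  upper = ℤ.≤-<-trans (ℤ.+-monoʳ-≤ (ℤ.- 1ℤ) (ℤ.neg-mono-≤ 0≤i)) ℤ.-<+

-- Counting the exceptional indices.

module Count (r₁ r₃ r₅ g₁ u : ℤ) .{{_ : NonZero r₅}} .{{_ : NonZero g₁}} where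
  -- `r₁` stands in the place of `r₂`: the quantities taken from `Formula` here stay fixed while
  -- `r₂` varies.
  open Formula r₁ r₁ r₃ r₅ g₁

  instance
    _ : NonZero d
    _ = d-nonZero
    _ : NonZero m
    _ = m-nonZero

  d∣r₅ : d ∣ r₅
  d∣r₅ = ∣ᵤ⇒∣ (ℤ.gcd[i,j]∣i r₅ g₁)

  d∣g₁ : d ∣ g₁
  d∣g₁ = ∣ᵤ⇒∣ (ℤ.gcd[i,j]∣j r₅ g₁)

  -- The sign of `g₁` is lost, which divisibility does not see; `m∣∣m∣` and `∣m∣∣m` pass between the
  -- two forms.
  m*d≡∣g₁∣ : m ℤ.* d ≡ + ℤ.∣ g₁ ∣
  m*d≡∣g₁∣ = ∣⇒/*≡ (∣-trans d∣g₁ m∣∣m∣)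

  0<m : 0ℤ ℤ.< m
  0<m = ℤ.≤∧≢⇒< (ℤ.0≤n⇒0≤n/d (+ ℤ.∣ g₁ ∣) d (ℤ.+≤+ ℕ.z≤n) (ℤ.+≤+ ℕ.z≤n))
    (λ 0≡m → ℕ.≢-nonZero⁻¹ ℤ.∣ m ∣ (cong ℤ.∣_∣ (sym 0≡m)))

  first : ℤ
  first = ((r₃ ℤ./ d) ℤ.- (r₁′ ℤ.- 1ℤ) ℤ.* r₅/d) ℤ.* u

  ρ : ℤ
  ρ = first ℤ.- floor (first ÷ᶻ m) ℤ.* m

  r≡ρ : r u ≡ ι ρ
  r≡ρ = frac-÷ᶻ-* first m

  -- When `u` is an inverse and `n ≥ -1`, this is the number of `j` from `r₁′ - 1` to `r₁′ - 1 + n`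
  -- with `g₁ ∣ j r₅ - r₃`. The correction `q u` is its value at `n = r₂′ - r₁′ + 2`.
  counted : ℤ → ℤ
  counted n = if does (d ∣? r₃)
    then floor (((ι n - r u) ℚ.÷ ι m) {{ι-nonZero m}}) ℤ.+ 1ℤ
    else 0ℤ

  floor-r : ∀ n → floor (((ι n - r u) ℚ.÷ ι m) {{ι-nonZero m}}) ≡ floor ((n ℤ.- ρ) ÷ᶻ m)
  floor-r n = cong floor (cong (λ p → (p ℚ.÷ ι m) {{ι-nonZero m}})
    (trans (cong (λ p → ι n - p) r≡ρ) (sym (ι-- n ρ))))

  -- The integers j with g₁ ∣ j r₅ - r₃ form, when d ∣ r₃, one residue class
  -- modulo m, namely that of ρ + (r₁′ - 1).
  residue : IsInverse u → d ∣ r₃ → ∀ n →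
    (m ∣ n ℤ.- ρ) ⇔ (g₁ ∣ (n ℤ.+ (r₁′ ℤ.- 1ℤ)) ℤ.* r₅ ℤ.- r₃)
  residue inv d∣r₃ n = mk⇔ to from
    where
    R a w : ℤ
    R = r₃ ℤ./ d
    a = r₁′ ℤ.- 1ℤ
    w = floor (first ÷ᶻ m)
    scaled : ((n ℤ.+ a) ℤ.* r₅/d ℤ.- R) ℤ.* d ≡ (n ℤ.+ a) ℤ.* r₅ ℤ.- r₃
    scaled = trans (distrib (n ℤ.+ a) r₅/d R d)
      (cong₂ (λ i j → (n ℤ.+ a) ℤ.* i ℤ.- j) (∣⇒/*≡ d∣r₅) (∣⇒/*≡ d∣r₃))
      where
      distrib : ∀ x y z d → (x ℤ.* y ℤ.- z) ℤ.* d ≡ x ℤ.* (y ℤ.* d) ℤ.- z ℤ.* d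
      distrib = ℤ.solve-∀
    -- Both directions pass through `m ∣ (n + a) * r₅/d - R`, which `scaled` turns into divisibility
    -- by `g₁`. To reach it `n - ρ` is multiplied by `r₅/d`; to leave it the multiplier is `u`.
    -- Multiples of `u * r₅/d - 1` and of `m` absorb the difference.
    to : m ∣ n ℤ.- ρ → g₁ ∣ (n ℤ.+ a) ℤ.* r₅ ℤ.- r₃
    to m∣n-ρ = subst (g₁ ∣_) scaled (∣-trans (subst (g₁ ∣_) (sym m*d≡∣g₁∣) m∣∣m∣)
      (*-monoˡ-∣ d (subst (m ∣_) (identity n a r₅/d R u w m)
        (∣m∣n⇒∣m-n (∣m∣n⇒∣m+n (∣n⇒∣m*n r₅/d m∣n-ρ) (∣n⇒∣m*n (R ℤ.- a ℤ.* r₅/d) inv))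
          (∣n⇒∣m*n (r₅/d ℤ.* w) ∣-refl)))))
      where
      identity : ∀ n a e R u w m →
        e ℤ.* (n ℤ.- ((R ℤ.- a ℤ.* e) ℤ.* u ℤ.- w ℤ.* m))
            ℤ.+ (R ℤ.- a ℤ.* e) ℤ.* (u ℤ.* e ℤ.- 1ℤ) ℤ.- (e ℤ.* w) ℤ.* m
          ≡ (n ℤ.+ a) ℤ.* e ℤ.- R
      identity = ℤ.solve-∀
    from : g₁ ∣ (n ℤ.+ a) ℤ.* r₅ ℤ.- r₃ → m ∣ n ℤ.- ρ
    from g₁∣ = subst (m ∣_) (identity n a r₅/d R u w m)
      (∣m∣n⇒∣m+n (∣m∣n⇒∣m-n (∣n⇒∣m*n u m∣) (∣n⇒∣m*n n inv)) (∣n⇒∣m*n w ∣-refl))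
      where
      m∣ : m ∣ (n ℤ.+ a) ℤ.* r₅/d ℤ.- R
      m∣ = *-cancelʳ-∣ d (subst₂ _∣_ (sym m*d≡∣g₁∣) (sym scaled) (∣-trans ∣m∣∣m g₁∣))
      identity : ∀ n a e R u w m →
        u ℤ.* ((n ℤ.+ a) ℤ.* e ℤ.- R) ℤ.- n ℤ.* (u ℤ.* e ℤ.- 1ℤ) ℤ.+ w ℤ.* m
          ≡ n ℤ.- ((R ℤ.- a ℤ.* e) ℤ.* u ℤ.- w ℤ.* m)
      identity = ℤ.solve-∀

  -- Since `0 ≤ ρ < m`, the quotient `(-1 - ρ) / m` lies in `[-1, 0)`, and its floor cancels the
  -- `+ 1` of the formula.
  counted-empty : counted (ℤ.- 1ℤ) ≡ 0ℤ
  counted-empty with does (d ∣? r₃)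
  ... | false = refl
  ... | true = cong (ℤ._+ 1ℤ) (trans (floor-r (ℤ.- 1ℤ)) (floor-÷ᶻ-<0 ρ m 0<m 0≤ρ ρ<m))
    where
    0<ιm : 0ℚ < ι m
    0<ιm = ι-mono-< 0<m
    0≤ρ : 0ℤ ℤ.≤ ρ
    0≤ρ = ι-cancel-≤ {0ℤ} {ρ} (subst₂ _≤_ (ℚ.*-zeroˡ (ι m)) r≡ρ
      (ℚ.*-monoʳ-≤-nonNeg (ι m) {{ℚ.nonNegative (ℚ.<⇒≤ 0<ιm)}} (0≤frac (first ÷ᶻ m))))
    ρ<m : ρ ℤ.< m
    ρ<m = ι-cancel-< {ρ} {m} (subst₂ _<_ r≡ρ (ℚ.*-identityˡ (ι m))
      (ℚ.*-monoˡ-<-pos (ι m) {{ℚ.positive 0<ιm}} (frac<1 (first ÷ᶻ m))))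

  counted-step : IsInverse u → ∀ n → let j = n ℤ.+ 1ℤ ℤ.+ (r₁′ ℤ.- 1ℤ) in
    counted (n ℤ.+ 1ℤ) ≡ counted n ℤ.+ 𝟙 (g₁ ∣? j ℤ.* r₅ ℤ.- r₃)
  counted-step inv n = go (d ∣? r₃)
    where
    open ≡-Reasoning
    j N : ℤ
    j = n ℤ.+ 1ℤ ℤ.+ (r₁′ ℤ.- 1ℤ)
    N = j ℤ.* r₅ ℤ.- r₃
    go : (d∣?r₃ : Dec (d ∣ r₃)) →
      (if does d∣?r₃ then floor (((ι (n ℤ.+ 1ℤ) - r u) ℚ.÷ ι m) {{ι-nonZero m}}) ℤ.+ 1ℤ else 0ℤ) ≡
      (if does d∣?r₃ then floor (((ι n - r u) ℚ.÷ ι m) {{ι-nonZero m}}) ℤ.+ 1ℤ else 0ℤ)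
        ℤ.+ 𝟙 (g₁ ∣? N)
    -- `d` divides `r₅` and `g₁`, so `g₁ ∣ N` would force `d ∣ r₃`: no index is exceptional.
    go (no d∤r₃) = sym (cong (ℤ._+_ 0ℤ) (𝟙-false (g₁ ∣? N) λ g₁∣N → d∤r₃
      (subst (d ∣_) (difference (j ℤ.* r₅) r₃)
        (∣m∣n⇒∣m-n (∣n⇒∣m*n j d∣r₅) (∣-trans d∣g₁ g₁∣N)))))
      where
      difference : ∀ x y → x ℤ.- (x ℤ.- y) ≡ y
      difference = ℤ.solve-∀
    go (yes d∣r₃) = begin
      floor (((ι (n ℤ.+ 1ℤ) - r u) ℚ.÷ ι m) {{ι-nonZero m}}) ℤ.+ 1ℤ
        ≡⟨ cong (ℤ._+ 1ℤ) (floor-r (n ℤ.+ 1ℤ)) ⟩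
      floor ((n ℤ.+ 1ℤ ℤ.- ρ) ÷ᶻ m) ℤ.+ 1ℤ
        ≡⟨ cong (λ i → floor (i ÷ᶻ m) ℤ.+ 1ℤ) (swap n ρ) ⟩
      floor ((n ℤ.- ρ ℤ.+ 1ℤ) ÷ᶻ m) ℤ.+ 1ℤ
        ≡⟨ cong (ℤ._+ 1ℤ) (floor-÷ᶻ-step (n ℤ.- ρ) m 0<m) ⟩
      floor ((n ℤ.- ρ) ÷ᶻ m) ℤ.+ 𝟙 (m ∣? n ℤ.- ρ ℤ.+ 1ℤ) ℤ.+ 1ℤ
        ≡⟨ cong₂ (λ i b → i ℤ.+ b ℤ.+ 1ℤ) (sym (floor-r n)) same ⟩
      floor (((ι n - r u) ℚ.÷ ι m) {{ι-nonZero m}}) ℤ.+ 𝟙 (g₁ ∣? N) ℤ.+ 1ℤ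
        ≡⟨ right-swap (floor (((ι n - r u) ℚ.÷ ι m) {{ι-nonZero m}})) (𝟙 (g₁ ∣? N)) ⟩
      floor (((ι n - r u) ℚ.÷ ι m) {{ι-nonZero m}}) ℤ.+ 1ℤ ℤ.+ 𝟙 (g₁ ∣? N) ∎
      where
      swap : ∀ x y → x ℤ.+ 1ℤ ℤ.- y ≡ x ℤ.- y ℤ.+ 1ℤ
      swap = ℤ.solve-∀
      right-swap : ∀ x y → x ℤ.+ y ℤ.+ 1ℤ ≡ x ℤ.+ 1ℤ ℤ.+ y
      right-swap = ℤ.solve-∀
      same : 𝟙 (m ∣? n ℤ.- ρ ℤ.+ 1ℤ) ≡ 𝟙 (g₁ ∣? N)
      same = trans (cong (λ i → 𝟙 (m ∣? i)) (sym (swap n ρ)))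
        (cong (if_then 1ℤ else 0ℤ)
          (does-⇔ (residue inv d∣r₃ (n ℤ.+ 1ℤ)) (m ∣? n ℤ.+ 1ℤ ℤ.- ρ) (g₁ ∣? N)))

-- The closed form for the two families of floors.

module LatticePoints (r₁ r₃ r₅ g₁ u : ℤ) .{{_ : NonZero r₅}} .{{_ : NonZero g₁}}
  (0<α : 0ℚ < g₁ ÷ᶻ r₅) (α<1 : g₁ ÷ᶻ r₅ < 1ℚ) (inv : Formula.IsInverse r₁ r₁ r₃ r₅ g₁ u) where
  open Formula r₁ r₁ r₃ r₅ g₁ using (r₁′)
  open Staircase r₃ g₁ r₅ 0<α α<1
  open Count r₁ r₃ r₅ g₁ u

  -- `G` is written as in the summands of the second `S`, `H` as in the floors of `A`.
  G H : ℤ → ℤ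
  G j = floor ((ℤ.- r₃ ℤ.+ r₅ ℤ.* j) ÷ᶻ g₁)
  H j = floor ((j ℤ.* r₅ ℤ.- r₃) ÷ᶻ g₁)

  G≡H : ∀ j → G j ≡ H j
  G≡H j = cong (λ i → floor (i ÷ᶻ g₁)) (lemma r₃ r₅ j)
    where
    lemma : ∀ c k j → ℤ.- c ℤ.+ k ℤ.* j ≡ j ℤ.* k ℤ.- c
    lemma = ℤ.solve-∀

  -- The integer between the large brackets of A, at r₂ = y and r₂′ = b - 1.
  Z : ℤ → ℤ → ℤ
  Z y b = ℤ.- H (r₁′ ℤ.- 1ℤ) ℤ.+ (r₁′ ℤ.- + 2) ℤ.* (ℤ.- r₁ ℤ.+ 1ℤ)
    ℤ.+ counted (b ℤ.- 1ℤ ℤ.- r₁′ ℤ.+ + 2)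
    ℤ.- H (b ℤ.- 1ℤ ℤ.+ 1ℤ) ℤ.+ (b ℤ.- 1ℤ ℤ.+ 1ℤ) ℤ.* y

  Z-flat : ∀ y b → Z (y ℤ.+ 1ℤ) b ≡ Z y b ℤ.+ b
  Z-flat y b = lemma (ℤ.- H (r₁′ ℤ.- 1ℤ) ℤ.+ (r₁′ ℤ.- + 2) ℤ.* (ℤ.- r₁ ℤ.+ 1ℤ)
    ℤ.+ counted (b ℤ.- 1ℤ ℤ.- r₁′ ℤ.+ + 2)
    ℤ.- H (b ℤ.- 1ℤ ℤ.+ 1ℤ)) b y
    where
    lemma : ∀ x b y → x ℤ.+ (b ℤ.- 1ℤ ℤ.+ 1ℤ) ℤ.* (y ℤ.+ 1ℤ) ≡ x ℤ.+ (b ℤ.- 1ℤ ℤ.+ 1ℤ) ℤ.* y ℤ.+ b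
    lemma = ℤ.solve-∀

  -- By `stair-inverse` the new floor `H (b + 1)` is `y + δ`, and the count grows by the same `δ`,
  -- so the two cancel. The `G`-sum gains the index `b`, one behind the new level, because it stops
  -- at `r₂′ = b - 1`; the old `H b` in `Z` supplies that term.
  Z-jump : ∀ y → let b = stair y in stair (y ℤ.+ 1ℤ) ≡ b ℤ.+ 1ℤ →
    Z (y ℤ.+ 1ℤ) (b ℤ.+ 1ℤ) ≡ Z y b ℤ.+ (b ℤ.+ 1ℤ) ℤ.+ G (b ℤ.- 1ℤ ℤ.+ 1ℤ)
  Z-jump y jump = begin
    x ℤ.+ counted (b ℤ.+ 1ℤ ℤ.- 1ℤ ℤ.- r₁′ ℤ.+ + 2) ℤ.- H (b ℤ.+ 1ℤ ℤ.- 1ℤ ℤ.+ 1ℤ)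
      ℤ.+ (b ℤ.+ 1ℤ ℤ.- 1ℤ ℤ.+ 1ℤ) ℤ.* (y ℤ.+ 1ℤ)
      ≡⟨ cong₂ (λ i j → x ℤ.+ i ℤ.- j ℤ.+ (b ℤ.+ 1ℤ ℤ.- 1ℤ ℤ.+ 1ℤ) ℤ.* (y ℤ.+ 1ℤ))
           counted-jump H-jump ⟩
    x ℤ.+ (counted n ℤ.+ δ) ℤ.- (y ℤ.+ δ) ℤ.+ (b ℤ.+ 1ℤ ℤ.- 1ℤ ℤ.+ 1ℤ) ℤ.* (y ℤ.+ 1ℤ)
      ≡⟨ identity x (counted n) δ (H (b ℤ.- 1ℤ ℤ.+ 1ℤ)) b y ⟩
    x ℤ.+ counted n ℤ.- H (b ℤ.- 1ℤ ℤ.+ 1ℤ) ℤ.+ (b ℤ.- 1ℤ ℤ.+ 1ℤ) ℤ.* y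
      ℤ.+ (b ℤ.+ 1ℤ) ℤ.+ H (b ℤ.- 1ℤ ℤ.+ 1ℤ)
      ≡⟨ cong (ℤ._+_ (Z y b ℤ.+ (b ℤ.+ 1ℤ))) (G≡H (b ℤ.- 1ℤ ℤ.+ 1ℤ)) ⟨
    Z y b ℤ.+ (b ℤ.+ 1ℤ) ℤ.+ G (b ℤ.- 1ℤ ℤ.+ 1ℤ) ∎
    where
    open ≡-Reasoning
    b n x δ : ℤ
    b = stair y
    n = b ℤ.- 1ℤ ℤ.- r₁′ ℤ.+ + 2
    x = ℤ.- H (r₁′ ℤ.- 1ℤ) ℤ.+ (r₁′ ℤ.- + 2) ℤ.* (ℤ.- r₁ ℤ.+ 1ℤ)
    δ = 𝟙 (g₁ ∣? (b ℤ.+ 1ℤ) ℤ.* r₅ ℤ.- r₃)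
    counted-jump : counted (b ℤ.+ 1ℤ ℤ.- 1ℤ ℤ.- r₁′ ℤ.+ + 2) ≡ counted n ℤ.+ δ
    counted-jump = begin
      counted (b ℤ.+ 1ℤ ℤ.- 1ℤ ℤ.- r₁′ ℤ.+ + 2) ≡⟨ cong counted (shift b r₁′) ⟩
      counted (n ℤ.+ 1ℤ)                        ≡⟨ counted-step inv n ⟩
      counted n ℤ.+ 𝟙 (g₁ ∣? (n ℤ.+ 1ℤ ℤ.+ (r₁′ ℤ.- 1ℤ)) ℤ.* r₅ ℤ.- r₃)
        ≡⟨ cong (λ j → counted n ℤ.+ 𝟙 (g₁ ∣? j ℤ.* r₅ ℤ.- r₃)) (unshift b r₁′) ⟩
      counted n ℤ.+ δ ∎
      where
      shift : ∀ b a → b ℤ.+ 1ℤ ℤ.- 1ℤ ℤ.- a ℤ.+ + 2 ≡ b ℤ.- 1ℤ ℤ.- a ℤ.+ + 2 ℤ.+ 1ℤ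
      shift = ℤ.solve-∀
      unshift : ∀ b a → b ℤ.- 1ℤ ℤ.- a ℤ.+ + 2 ℤ.+ 1ℤ ℤ.+ (a ℤ.- 1ℤ) ≡ b ℤ.+ 1ℤ
      unshift = ℤ.solve-∀
    H-jump : H (b ℤ.+ 1ℤ ℤ.- 1ℤ ℤ.+ 1ℤ) ≡ y ℤ.+ δ
    H-jump = trans (cong H (back b)) (stair-inverse y jump)
      where
      back : ∀ b → b ℤ.+ 1ℤ ℤ.- 1ℤ ℤ.+ 1ℤ ≡ b ℤ.+ 1ℤ
      back = ℤ.solve-∀
    identity : ∀ x c δ h b y →
      x ℤ.+ (c ℤ.+ δ) ℤ.- (y ℤ.+ δ) ℤ.+ (b ℤ.+ 1ℤ ℤ.- 1ℤ ℤ.+ 1ℤ) ℤ.* (y ℤ.+ 1ℤ) ≡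
      x ℤ.+ c ℤ.- h ℤ.+ (b ℤ.- 1ℤ ℤ.+ 1ℤ) ℤ.* y ℤ.+ (b ℤ.+ 1ℤ) ℤ.+ h
    identity = ℤ.solve-∀

  -- At `r₂ = r₁` the two floors in `Z` sit at `a + 1` and `a`, the count is taken at -1, hence
  -- zero, and the products collapse to `a`.
  Z-base : let a = stair r₁ in Z r₁ a ≡ a ℤ.- (G (a ℤ.- 1ℤ ℤ.+ 1ℤ) ℤ.+ G (a ℤ.- 1ℤ ℤ.+ 1ℤ ℤ.+ 1ℤ))
  Z-base = begin
    Z r₁ a
      ≡⟨ cong₂ (λ j c → ℤ.- H j ℤ.+ (r₁′ ℤ.- + 2) ℤ.* (ℤ.- r₁ ℤ.+ 1ℤ) ℤ.+ c ℤ.- h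
             ℤ.+ (a ℤ.- 1ℤ ℤ.+ 1ℤ) ℤ.* r₁)
           (index a) (trans (cong counted (before a)) counted-empty) ⟩
    ℤ.- h′ ℤ.+ (r₁′ ℤ.- + 2) ℤ.* (ℤ.- r₁ ℤ.+ 1ℤ) ℤ.+ 0ℤ ℤ.- h ℤ.+ (a ℤ.- 1ℤ ℤ.+ 1ℤ) ℤ.* r₁
      ≡⟨ identity h′ h a r₁ ⟩
    a ℤ.- (h ℤ.+ h′)
      ≡⟨ cong₂ (λ i j → a ℤ.- (i ℤ.+ j)) (G≡H (a ℤ.- 1ℤ ℤ.+ 1ℤ)) (G≡H (a ℤ.- 1ℤ ℤ.+ 1ℤ ℤ.+ 1ℤ)) ⟨
    a ℤ.- (G (a ℤ.- 1ℤ ℤ.+ 1ℤ) ℤ.+ G (a ℤ.- 1ℤ ℤ.+ 1ℤ ℤ.+ 1ℤ)) ∎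
    where
    open ≡-Reasoning
    a h h′ : ℤ
    a = stair r₁
    h = H (a ℤ.- 1ℤ ℤ.+ 1ℤ)
    h′ = H (a ℤ.- 1ℤ ℤ.+ 1ℤ ℤ.+ 1ℤ)
    index : ∀ a → a ℤ.+ + 2 ℤ.- 1ℤ ≡ a ℤ.- 1ℤ ℤ.+ 1ℤ ℤ.+ 1ℤ
    index = ℤ.solve-∀
    before : ∀ a → a ℤ.- 1ℤ ℤ.- (a ℤ.+ + 2) ℤ.+ + 2 ≡ ℤ.- 1ℤ
    before = ℤ.solve-∀
    identity : ∀ h′ h a r →
      ℤ.- h′ ℤ.+ (a ℤ.+ + 2 ℤ.- + 2) ℤ.* (ℤ.- r ℤ.+ 1ℤ) ℤ.+ 0ℤ ℤ.- h ℤ.+ (a ℤ.- 1ℤ ℤ.+ 1ℤ) ℤ.* r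
        ≡ a ℤ.- (h ℤ.+ h′)
    identity = ℤ.solve-∀

  -- The level `b` is a separate argument, so that either outcome of `stair-step` can be substituted
  -- by `cong`.
  defect : ℤ → ℤ → ℚ
  defect y b = ∑ (ι ∘ stair) r₁ y + ∑ (ι ∘ G) r₁′ (b ℤ.- 1ℤ) - ι (Z y b)

  defect-flat : ∀ y → stair (y ℤ.+ 1ℤ) ≡ stair y → defect (y ℤ.+ 1ℤ) (stair y) ≡ defect y (stair y)
  defect-flat y flat = begin
    ∑ (ι ∘ stair) r₁ (y ℤ.+ 1ℤ) + ΣG - ι (Z (y ℤ.+ 1ℤ) b)
      ≡⟨ cong₂ (λ p q → p + ΣG - q)
           (trans (∑-step (ι ∘ stair) r₁ y) (cong (λ i → ΣF + ι i) flat))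
           (trans (cong ι (Z-flat y b)) (ι-+ (Z y b) b)) ⟩
    ΣF + ι b + ΣG - (ι (Z y b) + ι b)
      ≡⟨ identity ΣF ΣG (ι (Z y b)) (ι b) ⟩
    ΣF + ΣG - ι (Z y b) ∎
    where
    open ≡-Reasoning
    b : ℤ
    b = stair y
    ΣF ΣG : ℚ
    ΣF = ∑ (ι ∘ stair) r₁ y
    ΣG = ∑ (ι ∘ G) r₁′ (b ℤ.- 1ℤ)
    identity : ∀ f g z x → f + x + g - (z + x) ≡ f + g - z
    identity = solve-∀ ℚ-ring

  defect-jump : ∀ y → stair (y ℤ.+ 1ℤ) ≡ stair y ℤ.+ 1ℤ →
    defect (y ℤ.+ 1ℤ) (stair y ℤ.+ 1ℤ) ≡ defect y (stair y)
  defect-jump y jump = begin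
    ∑ (ι ∘ stair) r₁ (y ℤ.+ 1ℤ) + ∑ (ι ∘ G) r₁′ (b ℤ.+ 1ℤ ℤ.- 1ℤ) - ι (Z (y ℤ.+ 1ℤ) (b ℤ.+ 1ℤ))
      ≡⟨ cong₂ (λ p q → p + q - ι (Z (y ℤ.+ 1ℤ) (b ℤ.+ 1ℤ)))
           (trans (∑-step (ι ∘ stair) r₁ y) (cong (λ i → ΣF + ι i) jump))
           (trans (cong (∑ (ι ∘ G) r₁′) (swap b)) (∑-step (ι ∘ G) r₁′ (b ℤ.- 1ℤ))) ⟩
    ΣF + ι (b ℤ.+ 1ℤ) + (ΣG + ι (G b′)) - ι (Z (y ℤ.+ 1ℤ) (b ℤ.+ 1ℤ))
      ≡⟨ cong (λ q → ΣF + ι (b ℤ.+ 1ℤ) + (ΣG + ι (G b′)) - q)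
           (trans (cong ι (Z-jump y jump)) (trans (ι-+ (Z y b ℤ.+ (b ℤ.+ 1ℤ)) (G b′))
             (cong (_+ ι (G b′)) (ι-+ (Z y b) (b ℤ.+ 1ℤ))))) ⟩
    ΣF + ι (b ℤ.+ 1ℤ) + (ΣG + ι (G b′)) - (ι (Z y b) + ι (b ℤ.+ 1ℤ) + ι (G b′))
      ≡⟨ identity ΣF ΣG (ι (Z y b)) (ι (b ℤ.+ 1ℤ)) (ι (G b′)) ⟩
    ΣF + ΣG - ι (Z y b) ∎
    where
    open ≡-Reasoning
    b b′ : ℤ
    b = stair y
    b′ = b ℤ.- 1ℤ ℤ.+ 1ℤ
    ΣF ΣG : ℚ
    ΣF = ∑ (ι ∘ stair) r₁ y
    ΣG = ∑ (ι ∘ G) r₁′ (b ℤ.- 1ℤ)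
    swap : ∀ b → b ℤ.+ 1ℤ ℤ.- 1ℤ ≡ b ℤ.- 1ℤ ℤ.+ 1ℤ
    swap = ℤ.solve-∀
    identity : ∀ f g z x w → f + x + (g + w) - (z + x + w) ≡ f + g - z
    identity = solve-∀ ℚ-ring

  defect-base : defect r₁ (stair r₁) ≡ 0ℚ
  defect-base = begin
    ∑ (ι ∘ stair) r₁ r₁ + ∑ (ι ∘ G) r₁′ (a ℤ.- 1ℤ) - ι (Z r₁ a)
      ≡⟨ cong₂ (λ p q → p + q - ι (Z r₁ a))
           (∑-nonNeg (ι ∘ stair) {r₁} {r₁} {1} (one r₁))
           -- From `a + 2` to `a - 1` the oriented length is -2: the sum is minus the terms at `a`
           -- and `a + 1`, which match the floors in `Z-base`.
           (∑-neg (ι ∘ G) {r₁′} {a ℤ.- 1ℤ} {1} (minus-two a)) ⟩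
    ι a + 0ℚ + - (ι x + (ι y + 0ℚ)) - ι (Z r₁ a)
      ≡⟨ cong (λ p → ι a + 0ℚ + - (ι x + (ι y + 0ℚ)) - p)
           (trans (cong ι Z-base) (trans (ι-- a (x ℤ.+ y)) (cong (λ p → ι a - p) (ι-+ x y)))) ⟩
    ι a + 0ℚ + - (ι x + (ι y + 0ℚ)) - (ι a - (ι x + ι y))
      ≡⟨ identity (ι a) (ι x) (ι y) ⟩
    0ℚ ∎
    where
    open ≡-Reasoning
    a x y : ℤ
    a = stair r₁
    x = G (a ℤ.- 1ℤ ℤ.+ 1ℤ)
    y = G (a ℤ.- 1ℤ ℤ.+ 1ℤ ℤ.+ 1ℤ)
    one : ∀ a → a ℤ.- a ℤ.+ 1ℤ ≡ 1ℤ
    one = ℤ.solve-∀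
    minus-two : ∀ a → a ℤ.- 1ℤ ℤ.- (a ℤ.+ + 2) ℤ.+ 1ℤ ≡ -[1+ 1 ]
    minus-two = ℤ.solve-∀
    identity : ∀ a x y → a + 0ℚ + - (x + (y + 0ℚ)) - (a - (x + y)) ≡ 0ℚ
    identity = solve-∀ ℚ-ring

  defect≡0 : ∀ y → defect y (stair y) ≡ 0ℚ
  defect≡0 y = trans (+1-invariant (λ y → defect y (stair y)) step y r₁) defect-base
    where
    step : ∀ y → defect (y ℤ.+ 1ℤ) (stair (y ℤ.+ 1ℤ)) ≡ defect y (stair y)
    step y with stair-step y
    ... | inj₁ flat = trans (cong (defect (y ℤ.+ 1ℤ)) flat) (defect-flat y flat)
    ... | inj₂ jump = trans (cong (defect (y ℤ.+ 1ℤ)) jump) (defect-jump y jump)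

-- Fractional part sums in terms of floors, and the conclusion.

S-closed : ∀ a b c e k .{{_ : NonZero k}} →
  S a b c e k ≡ ι (b ℤ.- a ℤ.+ 1ℤ) * ι c + ι e * (½ * ι ((b ℤ.+ a) ℤ.* (b ℤ.- a ℤ.+ 1ℤ)))
    - ι k * ∑ (λ x → ι (floor ((c ℤ.+ e ℤ.* x) ÷ᶻ k))) a b
S-closed a b c e k = trans (∑-cong pointwise a b) (∑-linear c e (ι k) (λ x → ι (fl x)) a b)
  where
  fl : ℤ → ℤ
  fl x = floor ((c ℤ.+ e ℤ.* x) ÷ᶻ k)
  pointwise : ∀ x → frac ((c ℤ.+ e ℤ.* x) ÷ᶻ k) * ι k ≡ ι (c ℤ.+ e ℤ.* x) - ι k * ι (fl x)
  pointwise x = trans (frac-÷ᶻ-* (c ℤ.+ e ℤ.* x) k)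
    (trans (ι-- (c ℤ.+ e ℤ.* x) (fl x ℤ.* k)) (cong (λ p → ι (c ℤ.+ e ℤ.* x) - p)
      (trans (ι-* (fl x) k) (ℚ.*-comm (ι (fl x)) (ι k)))))

-- Lets `g₁` replace `r₄` in the first sum: each argument of `frac` moves by the integer `i * x`.
S-mod : ∀ a b c e e′ i k .{{_ : NonZero k}} → e ≡ e′ ℤ.+ i ℤ.* k → S a b c e k ≡ S a b c e′ k
S-mod a b c e e′ i k refl = ∑-cong (λ x → cong (_* ι k)
  (trans (cong frac (split x)) (frac-+ι ((c ℤ.+ e′ ℤ.* x) ÷ᶻ k) (i ℤ.* x)))) a b
  where
  expand : ∀ c e′ i k x → c ℤ.+ (e′ ℤ.+ i ℤ.* k) ℤ.* x ≡ c ℤ.+ e′ ℤ.* x ℤ.+ i ℤ.* x ℤ.* k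
  expand = ℤ.solve-∀
  split : ∀ x → (c ℤ.+ (e′ ℤ.+ i ℤ.* k) ℤ.* x) ÷ᶻ k ≡ (c ℤ.+ e′ ℤ.* x) ÷ᶻ k + ι (i ℤ.* x)
  split x = trans (cong (_÷ᶻ k) (expand c e′ i k x))
    (trans (÷ᶻ-+ (c ℤ.+ e′ ℤ.* x) (i ℤ.* x ℤ.* k) k)
      (cong (_+_ ((c ℤ.+ e′ ℤ.* x) ÷ᶻ k)) (*-÷ᶻ (i ℤ.* x) k)))

/2≡*½ : ∀ i → i ℚ./ 2 ≡ ι i * ½
/2≡*½ i rewrite ι-mkℚ i = cong (ℚ._/ 2) (sym (ℤ.*-identityʳ i))

÷ᶻ-2* : ∀ i j .{{_ : NonZero j}} → (i ÷ᶻ (+ 2 ℤ.* j)) {{ℤ.i*j≢0 (+ 2) j}} ≡ (i ÷ᶻ j) * ½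
÷ᶻ-2* i j = ÷ᶻ-unique i (+ 2 ℤ.* j) {{ℤ.i*j≢0 (+ 2) j}} (begin
  (i ÷ᶻ j) * ½ * ι (+ 2 ℤ.* j)          ≡⟨ cong (_*_ ((i ÷ᶻ j) * ½)) (ι-* (+ 2) j) ⟩
  (i ÷ᶻ j) * ½ * ((1ℚ + 1ℚ) * ι j)      ≡⟨ halve (i ÷ᶻ j) (ι j) ⟩
  (i ÷ᶻ j) * ι j                        ≡⟨ ÷ᶻ-* i j ⟩
  ι i                                   ∎)
  where
  open ≡-Reasoning
  halve : ∀ x y → x * ½ * ((1ℚ + 1ℚ) * y) ≡ x * y
  halve = solve-∀ ℚ-ring

p-q≡0⇒p≡q : ∀ p q → p - q ≡ 0ℚ → p ≡ q
p-q≡0⇒p≡q p q eq = trans (restore p q) (trans (cong (_+ q) eq) (ℚ.+-identityˡ q))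
  where
  restore : ∀ p q → p ≡ p - q + q
  restore = solve-∀ ℚ-ring

-- Here `s` is `r₅`, `g` is `g₁` and `w` is `1 / g₁`. To the ring solver `w` is a free variable, so
-- `s * w * g` is first isolated in front of `G` and then replaced by `s`, which puts both floor
-- sums under the same factor.
assemble : ∀ n c g t s F n′ t′ G w Z → s * w * g ≡ s → F + G ≡ Z →
  n * c + g * (½ * t) - s * F + s * w * (n′ * - c + s * (½ * t′) - g * G) ≡
  n * c + g * ½ * t - s * (Z + c * w * n′ - s * w * ½ * t′)
assemble n c g t s F n′ t′ G w _ swg≡s refl = begin
  n * c + g * (½ * t) - s * F + s * w * (n′ * - c + s * (½ * t′) - g * G)
    ≡⟨ collect n c g t s F n′ t′ G w ⟩
  n * c + g * ½ * t - s * (F + c * w * n′ - s * w * ½ * t′) - s * w * g * G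
    ≡⟨ cong (λ p → n * c + g * ½ * t - s * (F + c * w * n′ - s * w * ½ * t′) - p * G) swg≡s ⟩
  n * c + g * ½ * t - s * (F + c * w * n′ - s * w * ½ * t′) - s * G
    ≡⟨ factor (n * c + g * ½ * t) s F (c * w * n′) (s * w * ½ * t′) G ⟩
  n * c + g * ½ * t - s * (F + G + c * w * n′ - s * w * ½ * t′) ∎
  where
  open ≡-Reasoning
  collect : ∀ n c g t s F n′ t′ G w →
    n * c + g * (½ * t) - s * F + s * w * (n′ * - c + s * (½ * t′) - g * G) ≡
    n * c + g * ½ * t - s * (F + c * w * n′ - s * w * ½ * t′) - s * w * g * G
  collect = solve-∀ ℚ-ring
  factor : ∀ p s F x y G → p - s * (F + x - y) - s * G ≡ p - s * (F + G + x - y)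
  factor = solve-∀ ℚ-ring

theorem2p2 : (r₁ r₂ r₃ r₄ r₅ g₁ u : ℤ) .{{_ : NonZero r₅}} .{{_ : NonZero g₁}} →
    ι g₁ ≡ frac (r₄ ÷ᶻ r₅) ℚ.* ι r₅ →
    let open Formula r₁ r₂ r₃ r₅ g₁ in
    IsInverse u →
    S r₁ r₂ r₃ r₄ r₅ ℚ.+ (r₅ ÷ᶻ g₁) ℚ.* S r₁′ r₂′ (ℤ.- r₃) r₅ g₁ ≡ A u
theorem2p2 r₁ r₂ r₃ r₄ r₅ g₁ u g₁≡ inv = begin
  S r₁ r₂ r₃ r₄ r₅ + v * S r₁′ r₂′ (ℤ.- r₃) r₅ g₁
    ≡⟨ cong₂ (λ p q → p + v * q)
         (trans (S-mod r₁ r₂ r₃ r₄ g₁ k r₅ r₄≡) (S-closed r₁ r₂ r₃ g₁ r₅))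
         (trans (S-closed r₁′ r₂′ (ℤ.- r₃) r₅ g₁)
           (cong (λ p → ι n′ * p + ι r₅ * (½ * ι t′) - ι g₁ * ΣG) (ι-neg r₃))) ⟩
  ι n * ι r₃ + ι g₁ * (½ * ι t) - ι r₅ * ΣF + v * (ι n′ * - ι r₃ + ι r₅ * (½ * ι t′) - ι g₁ * ΣG)
    ≡⟨ assemble (ι n) (ι r₃) (ι g₁) (ι t) (ι r₅) ΣF (ι n′) (ι t′) ΣG w (ι (Z r₂ b)) (÷ᶻ-* r₅ g₁)
         (p-q≡0⇒p≡q (ΣF + ΣG) (ι (Z r₂ b)) (defect≡0 r₂)) ⟩
  ι n * ι r₃ + ι g₁ * ½ * ι t - ι r₅ * (ι (Z r₂ b) + (r₃ ÷ᶻ g₁) * ι n′ - v * ½ * ι t′)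
    ≡⟨ cong₂ (λ p q → p + q * ι t - ι r₅ * (ι (Z r₂ b) + (r₃ ÷ᶻ g₁) * ι n′ - v * ½ * ι t′))
         (ι-* n r₃) (/2≡*½ g₁) ⟨
  ι (n ℤ.* r₃) + (g₁ ℚ./ 2) * ι t - ι r₅ * (ι (Z r₂ b) + (r₃ ÷ᶻ g₁) * ι n′ - v * ½ * ι t′)
    ≡⟨ cong (λ p → ι (n ℤ.* r₃) + (g₁ ℚ./ 2) * ι t - ι r₅ * (ι (Z r₂ b) + (r₃ ÷ᶻ g₁) * ι n′ - p * ι t′))
         (÷ᶻ-2* r₅ g₁) ⟨
  -- `r₂′` unfolds to `b - 1` and `q u` to `counted`; `Z` keeps `b - 1 + 1` unsimplified so that it
  -- agrees with the bracket of `A u` by computation.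
  A u ∎
  where
  open ≡-Reasoning
  open Formula r₁ r₂ r₃ r₅ g₁

  α≡frac : g₁ ÷ᶻ r₅ ≡ frac (r₄ ÷ᶻ r₅)
  α≡frac = ÷ᶻ-unique g₁ r₅ (sym g₁≡)

  -- `frac` gives only `0 ≤`; strictness holds because a zero slope would make `g₁` zero. The sign
  -- of `r₅` does not matter.
  0<α : 0ℚ < g₁ ÷ᶻ r₅
  0<α = ℚ.≰⇒> λ α≤0 →
    let α≡0 = ℚ.≤-antisym α≤0 (subst (0ℚ ≤_) (sym α≡frac) (0≤frac (r₄ ÷ᶻ r₅)))
    in ℕ.≢-nonZero⁻¹ ℤ.∣ g₁ ∣ (cong ℤ.∣_∣ (ι-injective {g₁} {0ℤ}
      (trans (sym (÷ᶻ-* g₁ r₅)) (trans (cong (_* ι r₅) α≡0) (ℚ.*-zeroˡ (ι r₅))))))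

  α<1 : g₁ ÷ᶻ r₅ < 1ℚ
  α<1 = subst (_< 1ℚ) (sym α≡frac) (frac<1 (r₄ ÷ᶻ r₅))

  k : ℤ
  k = floor (r₄ ÷ᶻ r₅)

  r₄≡ : r₄ ≡ g₁ ℤ.+ k ℤ.* r₅
  r₄≡ = trans (restore r₄ (k ℤ.* r₅))
    (cong (ℤ._+ k ℤ.* r₅) (sym (ι-injective {g₁} {r₄ ℤ.- k ℤ.* r₅}
      (trans g₁≡ (frac-÷ᶻ-* r₄ r₅)))))
    where
    restore : ∀ x y → x ≡ x ℤ.- y ℤ.+ y
    restore = ℤ.solve-∀

  open LatticePoints r₁ r₃ r₅ g₁ u 0<α α<1 inv using (Z; G; defect≡0)

  b n n′ t t′ : ℤ
  b = floor ((r₃ ℤ.+ g₁ ℤ.* r₂) ÷ᶻ r₅)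
  n = r₂ ℤ.- r₁ ℤ.+ 1ℤ
  n′ = r₂′ ℤ.- r₁′ ℤ.+ 1ℤ
  t = (r₂ ℤ.+ r₁) ℤ.* n
  t′ = (r₂′ ℤ.+ r₁′) ℤ.* n′

  v w ΣF ΣG : ℚ
  v = r₅ ÷ᶻ g₁
  w = (ℚ.1/ ι g₁) {{ι-nonZero g₁}}
  ΣF = ∑ (λ x → ι (floor ((r₃ ℤ.+ g₁ ℤ.* x) ÷ᶻ r₅))) r₁ r₂
  ΣG = ∑ (λ j → ι (G j)) r₁′ r₂′
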